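{- There are connected nonisomorphic finite simple graphs $G,H$ on $78$ vertices, with the same degree sequence, such that $$b(G,H)\ge 51>50=Q(78).$$
   Context: For a finite simple graph $G$ and $v\in V(G)$, the graph $G-v$ (considered up to isomorphism) is a card of $G$, and the vertex deck of $G$ is the multiset $\mathcal D(G)=\{G-v : v\in V(G)\}$, with multiplicity. For graphs $G,H$ of the same order, $b(G,H)=|\mathcal D(G)\cap\mathcal D(H)|$ is the size of the multiset intersection; equivalently, $b(G,H)$ is the maximum $m$ for which there are $m$ distinct vertices $v_1,\dots,v_m$ of $G$ and $m$ distinct vertices $w_1,\dots,w_m$ of $H$ with $G-v_i\cong H-w_i$ for all $i$. Also $Q(n)=2\lfloor (n-1)/3\rfloor$. Two graphs have the same degree sequence if their multisets of vertex degrees agree. -}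

module Defs where

open import Data.Bool using (Bool; true; false)
import Data.Bool.Properties as Bool
open import Data.Fin using (Fin; punchIn; funToFin; finToFun)
open import Data.Fin.Permutation using (Permutation; permutation; _⟨$⟩ʳ_; _⟨$⟩ˡ_; inverseˡ; inverseʳ)
import Data.Fin.Properties as Fin
open import Data.Fin.Subset using (Subset; ∣_∣)
open import Data.List using (List; []; _∷_; length; map; tabulate; allFin)
open import Data.List.Relation.Unary.Any using (any?; _─_)
open import Data.Nat using (ℕ; suc; _*_; _∸_)
open import Data.Nat.DivMod using (_/_)
open import Data.Product using (∃; _,_)
import Data.Vec as Vec
open import Relation.Binary.Construct.Closure.ReflexiveTransitive using (Star)
open import Relation.Binary.PropositionalEquality using (_≡_; sym; trans; cong; cong₂)
open import Relation.Nullary using (Dec; yes; no)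
open import Relation.Nullary.Decidable using (map′; _×-dec_)

private
  variable
    m n : ℕ

record Graph (n : ℕ) : Set where
  field
    adj     : Fin n → Fin n → Bool
    adj-sym : ∀ u v → adj u v ≡ adj v u
    no-loop : ∀ v → adj v v ≡ false

open Graph public

Adjacent : Graph n → Fin n → Fin n → Set
Adjacent G u v = adj G u v ≡ true

Connected : Graph n → Set
Connected G = ∀ u v → Star (Adjacent G) u v

neighbourhood : Graph n → Fin n → Subset n
neighbourhood G v = Vec.tabulate (adj G v)

degree : Graph n → Fin n → ℕ
degree G v = ∣ neighbourhood G v ∣

-- Listed in vertex order, so degree sequences are to be compared up to _↭_.
degrees : Graph n → List ℕ
degrees G = tabulate (degree G)

infix 4 _≅_ _≅?_

_≅_ : Graph m → Graph n → Set
_≅_ {m} {n} G H =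
  ∃ λ (π : Permutation m n) → ∀ u v → adj G u v ≡ adj H (π ⟨$⟩ʳ u) (π ⟨$⟩ʳ v)

-- Isomorphism is decided by searching all pairs of functions, coded by
-- finToFun, for an adjacency-preserving one and its inverse.
abstract
  _≅?_ : (G : Graph m) (H : Graph n) → Dec (G ≅ H)
  _≅?_ {m} {n} G H = map′
    (λ (a , b , fg , gf , p) → permutation (finToFun {n} {m} a) (finToFun {m} {n} b) fg gf , p)
    (λ (π , p) →
      let f = π ⟨$⟩ʳ_
          g = π ⟨$⟩ˡ_
          f≗ = Fin.finToFun-funToFin f
          g≗ = Fin.finToFun-funToFin g
      in funToFin f , funToFin g
       , (λ y → trans (f≗ _) (trans (cong f (g≗ y)) (inverseʳ π)))
       , (λ x → trans (g≗ _) (trans (cong g (f≗ x)) (inverseˡ π)))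
       , (λ u v → trans (p u v) (sym (cong₂ (adj H) (f≗ u) (f≗ v)))))
    (Fin.any? λ a → Fin.any? λ b →
      let f = finToFun {n} {m} a
          g = finToFun {m} {n} b
      in Fin.all? (λ y → f (g y) Fin.≟ y)
         ×-dec Fin.all? (λ x → g (f x) Fin.≟ x)
         ×-dec Fin.all? (λ u → Fin.all? λ v → adj G u v Bool.≟ adj H (f u) (f v)))

infixl 6 _-ᵛ_

_-ᵛ_ : Graph (suc n) → Fin (suc n) → Graph n
G -ᵛ v = record
  { adj     = λ i j → adj G (punchIn v i) (punchIn v j)
  ; adj-sym = λ i j → adj-sym G (punchIn v i) (punchIn v j)
  ; no-loop = λ i → no-loop G (punchIn v i)
  }

deck : Graph (suc n) → List (Graph n)
deck {n} G = map (G -ᵛ_) (allFin (suc n))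

-- Intersection of multisets of isomorphism classes, represented by lists:
-- each entry of the first list is kept exactly when it can be paired with an
-- isomorphic entry of the second list that has not been used yet, so a class
-- occurs with the minimum of its two multiplicities.
infixr 5 _∩_

_∩_ : List (Graph n) → List (Graph n) → List (Graph n)
[]       ∩ Ys = []
(X ∷ Xs) ∩ Ys with any? (X ≅?_) Ys
... | yes X∈Ys = X ∷ (Xs ∩ (Ys ─ X∈Ys))
... | no  _    = Xs ∩ Ys

b : Graph (suc n) → Graph (suc n) → ℕ
b G H = length (deck G ∩ deck H)

Q : ℕ → ℕ
Q n = 2 * ((n ∸ 1) / 3)

{-# OPTIONS --safe #-}
module Submission where

-- A₄ contains no odd permutation, so it cannot carry the weights a, a+1, a+2, a+3
-- on four points to the same weights with two of them exchanged.  But once one of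
-- the three larger weights drops by one, two points have equal weight, and a
-- transposition preserves the weights.  Let the weights be the sizes 15, 16, 17, 18
-- of four classes of twins, attached to a 12-vertex gadget, indexed by the ordered
-- pairs of points, whose symmetries act on the four points as A₄.  Mirroring the
-- gadget gives a second graph, and deleting from both graphs the same one of the
-- 16 + 17 + 18 = 51 vertices in the three larger classes makes them isomorphic.

open import Defs
open import Data.Bool using (Bool; true; false; not; _∧_; _∨_; if_then_else_)
import Data.Bool.Properties as Bool
open import Data.Fin using (Fin; zero; suc; inject₁; punchIn; toℕ; #_)
open import Data.Fin.Permutation as Perm using (Permutation′; insert; insert-punchIn; _⟨$⟩ʳ_)
open import Data.Fin.Permutation.Components using (transpose)
open import Data.Fin.Properties as Fin using (all?; any?)
open import Data.Fin.Subset using (∣_∣)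
open import Data.List using (List; []; _∷_; _++_; map; length; drop; allFin)
import Data.List.Properties as List
open import Data.List.Membership.Setoid.Properties using (∈-++⁻)
open import Data.List.Relation.Binary.Permutation.Propositional using (_↭_; ↭-reflexive)
import Data.List.Relation.Binary.Permutation.Setoid as SetoidPermutation
import Data.List.Relation.Binary.Permutation.Setoid.Properties as PermutationProperties
open import Data.List.Relation.Binary.Sublist.Propositional using (_⊆_; []; _∷_; _∷ʳ_; ⊆-refl; ⊆-trans)
open import Data.List.Relation.Binary.Sublist.Propositional.Properties using (map⁺; drop-⊆)
open import Data.List.Relation.Unary.All as All using (All; []; _∷_)
open import Data.List.Relation.Unary.Any as Any using (Any; here; there; index; _─_)
open import Data.Nat using (ℕ; zero; suc; _+_; _≤_; _≥_; _>_; z≤n; s≤s)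
open import Data.Nat.GeneralisedArithmetic using (iterate)
import Data.Nat.Properties as ℕ
open import Data.Product using (∃; ∃₂; _×_; _,_; proj₁; proj₂)
open import Data.Product.Properties using (≡-dec)
open import Data.Sum using (inj₁; inj₂)
import Data.Vec as Vec
open import Function using (_∘_)
open import Relation.Binary using (Setoid; DecidableEquality)
open import Relation.Binary.Construct.Closure.ReflexiveTransitive using (Star; ε; _◅_; _◅◅_; reverse)
open import Relation.Binary.PropositionalEquality using (_≡_; refl; sym; trans; cong; cong₂; subst; module ≡-Reasoning)
open import Relation.Nullary using (¬_; Dec; does; yes; no; contradiction)
open import Relation.Nullary.Decidable using (from-yes; ¬?; _×-dec_; dec-true)

open import Algebra.Properties.CommutativeMonoid.Sum ℕ.+-0-commutativeMonoid
  using (sum; sum-permute; sum-remove; sum-cong-≗)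

-- Common cards

≅-setoid : ℕ → Setoid _ _
≅-setoid n = record
  { Carrier       = Graph n
  ; _≈_           = _≅_
  ; isEquivalence = record
    { refl  = Perm.id , λ u v → refl
    ; sym   = λ {G} {H} (π , p) → Perm.flip π , λ u v →
        trans (sym (cong₂ (adj H) (Perm.inverseʳ π) (Perm.inverseʳ π))) (sym (p _ _))
    ; trans = λ (π , p) (ρ , q) → π Perm.∘ₚ ρ , λ u v → trans (p u v) (q _ _)
    }
  }

─-⊆ : ∀ {a p} {A : Set a} {P : A → Set p} {xs : List A} (i : Any P xs) → (xs ─ i) ⊆ xs
─-⊆ (here _)  = _ ∷ʳ ⊆-refl
─-⊆ (there i) = refl ∷ ─-⊆ i

module _ {a ℓ} (S : Setoid a ℓ) where
  open Setoid S using (_≈_) renaming (Carrier to A; sym to ≈-sym)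
  open SetoidPermutation S using (prep; ↭-refl; ↭-sym; ↭-prep; ↭-swap; ↭-trans) renaming (_↭_ to _↭ₛ_)
  open PermutationProperties S using (↭-shift)

  ↭-─ : ∀ {x : A} {xs} (i : Any (x ≈_) xs) → xs ↭ₛ x ∷ (xs ─ i)
  ↭-─ (here x≈y)             = prep (≈-sym x≈y) ↭-refl
  ↭-─ {xs = y ∷ _} (there i) = ↭-trans (↭-prep y (↭-─ i)) (↭-swap y _ ↭-refl)

  ⊆⇒↭-++ : ∀ {xs ys : List A} → xs ⊆ ys → ∃ λ rs → ys ↭ₛ xs ++ rs
  ⊆⇒↭-++ [] = [] , ↭-refl
  ⊆⇒↭-++ {xs} (y ∷ʳ xs⊆ys) =
    let rs , ys↭ = ⊆⇒↭-++ xs⊆ys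
    in y ∷ rs , ↭-trans (↭-prep y ys↭) (↭-sym (↭-shift xs rs))
  ⊆⇒↭-++ (_∷_ {x} refl xs⊆ys) =
    let rs , ys↭ = ⊆⇒↭-++ xs⊆ys in rs , ↭-prep x ys↭

module _ {n : ℕ} where
  open SetoidPermutation (≅-setoid n) using (prep; ↭-refl; ↭-sym; ↭-trans) renaming (_↭_ to _↭ₛ_)
  open PermutationProperties (≅-setoid n) using (∈-resp-↭; drop-∷; ++⁺ʳ; ++⁺ˡ; ↭-shift)

  -- Greedy pairing loses nothing. The invariant is that `Zs` is still available in both lists, in
  -- `Ys` up to isomorphism with `Rs` left over.
  length-∩-≥ : ∀ {Xs Ys Zs Rs : List (Graph n)} → Zs ⊆ Xs → Ys ↭ₛ Zs ++ Rs →
               length Zs ≤ length (Xs ∩ Ys)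
  length-∩-≥ [] Ys↭ = z≤n
  length-∩-≥ {X ∷ Xs} {Ys} {Zs} {Rs} (.X ∷ʳ Zs⊆Xs) Ys↭ with Any.any? (X ≅?_) Ys
  ... | no  _    = length-∩-≥ Zs⊆Xs Ys↭
  ... | yes X∈Ys with ∈-++⁻ (≅-setoid n) {X} Zs (∈-resp-↭ {X} Ys↭ X∈Ys)
  -- The pairing uses up one card of `Zs`, and the pair just counted makes up for it.
  ...   | inj₁ X∈Zs = ℕ.≤-trans
            (ℕ.≤-reflexive (List.length-removeAt′ Zs (index X∈Zs)))
            (s≤s (length-∩-≥ (⊆-trans (─-⊆ X∈Zs) Zs⊆Xs)
              (drop-∷ (↭-trans (↭-sym (↭-─ (≅-setoid n) {X} X∈Ys))
                      (↭-trans Ys↭ (++⁺ʳ Rs (↭-─ (≅-setoid n) {X} X∈Zs)))))))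
  ...   | inj₂ X∈Rs = ℕ.m≤n⇒m≤1+n (length-∩-≥ Zs⊆Xs
              (drop-∷ (↭-trans (↭-sym (↭-─ (≅-setoid n) {X} X∈Ys))
                      (↭-trans Ys↭ (↭-trans (++⁺ˡ Zs (↭-─ (≅-setoid n) {X} X∈Rs))
                                            (↭-shift Zs _))))))
  length-∩-≥ {X ∷ Xs} {Ys} (refl ∷ Zs⊆Xs) Ys↭ with Any.any? (X ≅?_) Ys
  ... | no  X∉Ys = contradiction (∈-resp-↭ {X} (↭-sym Ys↭) (here (Setoid.refl (≅-setoid n) {X}))) X∉Ys
  ... | yes X∈Ys = s≤s (length-∩-≥ Zs⊆Xs
              (drop-∷ (↭-trans (↭-sym (↭-─ (≅-setoid n) {X} X∈Ys)) Ys↭)))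

  private
    map-≅ : ∀ (G H : Graph (suc n)) {vs} → All (λ v → (G -ᵛ v) ≅ (H -ᵛ v)) vs →
            map (H -ᵛ_) vs ↭ₛ map (G -ᵛ_) vs
    map-≅ G H []               = ↭-refl
    map-≅ G H {v ∷ _} (p ∷ ps) =
      prep (Setoid.sym (≅-setoid n) {G -ᵛ v} {H -ᵛ v} p) (map-≅ G H ps)

  b-≥ : ∀ (G H : Graph (suc n)) {vs} → vs ⊆ allFin (suc n) →
        All (λ v → (G -ᵛ v) ≅ (H -ᵛ v)) vs → length vs ≤ b G H
  b-≥ G H {vs} vs⊆ G≅H =
    let Rs , H↭ = ⊆⇒↭-++ (≅-setoid n) (map⁺ (H -ᵛ_) vs⊆)
    in subst (_≤ b G H) (List.length-map (G -ᵛ_) vs)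
         (length-∩-≥ (map⁺ (G -ᵛ_) vs⊆) (↭-trans H↭ (++⁺ʳ Rs (map-≅ G H G≅H))))

-- Relabelling

module _ {A : Set} (_≟_ : DecidableEquality A) where

  count : ∀ {n} → (Fin n → A) → A → ℕ
  count f c = sum (λ i → if does (f i ≟ c) then 1 else 0)

  private
    occurs : ∀ {n} (f : Fin n → A) c → 1 ≤ count f c → ∃ λ i → f i ≡ c
    occurs {suc n} f c 1≤ with f zero ≟ c
    ... | yes eq = zero , eq
    ... | no  _  = let i , eq = occurs (f ∘ suc) c 1≤ in suc i , eq

    count-head : ∀ {n} (f : Fin (suc n) → A) → 1 ≤ count f (f zero)
    count-head f rewrite dec-true (f zero ≟ f zero) refl = s≤s z≤n

  -- Send `zero` to an index `j` with the same value and delete both; the remaining counts still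
  -- agree, so induction applies.
  count-≡⇒permutation : ∀ {n} (f g : Fin n → A) → (∀ c → count f c ≡ count g c) →
                        ∃ λ (π : Permutation′ n) → ∀ i → f i ≡ g (π ⟨$⟩ʳ i)
  count-≡⇒permutation {zero}  f g f≈g = Perm.id , λ ()
  count-≡⇒permutation {suc n} f g f≈g = insert zero j π , λ where
      zero    → sym gj≡f0
      (suc i) → trans (f∘suc≗ i) (cong g (sym (insert-punchIn zero j π i)))
    where
    found : ∃ λ i → g i ≡ f zero
    found = occurs g (f zero) (subst (1 ≤_) (f≈g (f zero)) (count-head f))
    j = proj₁ found
    gj≡f0 = proj₂ found

    tails : ∀ c → count (f ∘ suc) c ≡ count (g ∘ punchIn j) c
    tails c = ℕ.+-cancelˡ-≡ (if does (f zero ≟ c) then 1 else 0) _ _ (begin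
      count f c
        ≡⟨ f≈g c ⟩
      count g c
        ≡⟨ sum-remove {i = j} (λ i → if does (g i ≟ c) then 1 else 0) ⟩
      (if does (g j ≟ c) then 1 else 0) + count (g ∘ punchIn j) c
        ≡⟨ cong (λ x → (if does (x ≟ c) then 1 else 0) + count (g ∘ punchIn j) c) gj≡f0 ⟩
      (if does (f zero ≟ c) then 1 else 0) + count (g ∘ punchIn j) c
        ∎)
      where open ≡-Reasoning

    rest = count-≡⇒permutation (f ∘ suc) (g ∘ punchIn j) tails
    π = proj₁ rest
    f∘suc≗ = proj₂ rest

-- Isomorphism invariants

∣tabulate∣ : ∀ {n} (f : Fin n → Bool) → ∣ Vec.tabulate f ∣ ≡ sum (λ i → if f i then 1 else 0)
∣tabulate∣ {zero}  f = refl
∣tabulate∣ {suc n} f with f zero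
... | true  = cong suc (∣tabulate∣ (f ∘ suc))
... | false = ∣tabulate∣ (f ∘ suc)

-- Weight 1 gives the degree; weighting by degrees gives the invariant that separates the two
-- graphs.
neighbourSum : ∀ {n} → Graph n → (Fin n → ℕ) → Fin n → ℕ
neighbourSum G w v = sum (λ u → if adj G v u then w u else 0)

module _ {n : ℕ} (G H : Graph n) (π : Permutation′ n)
         (π-adj : ∀ u v → adj G u v ≡ adj H (π ⟨$⟩ʳ u) (π ⟨$⟩ʳ v)) where

  neighbourSum-≅ : ∀ (w w′ : Fin n → ℕ) → (∀ u → w u ≡ w′ (π ⟨$⟩ʳ u)) →
                   ∀ v → neighbourSum G w v ≡ neighbourSum H w′ (π ⟨$⟩ʳ v)
  neighbourSum-≅ w w′ w≗ v = trans
    (sum-cong-≗ (λ u → cong₂ (λ a k → if a then k else 0) (π-adj v u) (w≗ u)))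
    (sym (sum-permute (λ u → if adj H (π ⟨$⟩ʳ v) u then w′ u else 0) π))

  degree-≅ : ∀ v → degree G v ≡ degree H (π ⟨$⟩ʳ v)
  degree-≅ v = trans (∣tabulate∣ (adj G v))
    (trans (neighbourSum-≅ (λ _ → 1) (λ _ → 1) (λ _ → refl) v) (sym (∣tabulate∣ (adj H (π ⟨$⟩ʳ v)))))

iterate-Star : ∀ {A : Set} {_~_ : A → A → Set} {f : A → A} → (∀ x → x ~ f x) →
               ∀ k x → Star _~_ x (iterate f x k)
iterate-Star x~fx zero    x = ε
iterate-Star x~fx (suc k) x = x~fx x ◅ iterate-Star x~fx k _

-- The two graphs

-- (i , i) labels the vertices of class i, and (i , j) with i ≢ j a gadget vertex.
Label : Set
Label = Fin 4 × Fin 4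

_≟ₗ_ : DecidableEquality Label
_≟ₗ_ = ≡-dec Fin._≟_ Fin._≟_

_==_ : Fin 4 → Fin 4 → Bool
i == j = does (i Fin.≟ j)

-- Left translation by i is a 3-cycle on the other points, and all these
-- 3-cycles induce the same orientation: (i , j , i * j , l) is an even
-- arrangement of the four points.
_*_ : Fin 4 → Fin 4 → Fin 4
i * j = Vec.lookup (Vec.lookup table i) j
  where
  open Vec using ([]; _∷_)
  table : Vec.Vec (Vec.Vec (Fin 4) 4) 4
  table = (# 0 ∷ # 2 ∷ # 3 ∷ # 1 ∷ [])
        ∷ (# 3 ∷ # 1 ∷ # 0 ∷ # 2 ∷ [])
        ∷ (# 1 ∷ # 3 ∷ # 2 ∷ # 0 ∷ [])
        ∷ (# 2 ∷ # 0 ∷ # 1 ∷ # 3 ∷ [])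
        ∷ []

follows : Bool → Fin 4 → Fin 4 → Fin 4 → Bool
follows true  i j k = k == (i * j)
follows false i j k = j == (i * k)

-- A gadget vertex (i , j) is joined to class i, to (j , i), and to (j , k) with
-- k following j around i in the chosen orientation.
arc : Bool → Label → Label → Bool
arc o (i , j) (k , l) = not (i == j) ∧
  (((k == i) ∧ (l == i)) ∨ ((k == j) ∧ ((l == i) ∨ follows o i j l)))

link : Bool → Label → Label → Bool
link o x y = arc o x y ∨ arc o y x

link-irrefl : ∀ o x → link o x x ≡ false
link-irrefl o (i , j) = lemma o i j
  where
  lemma : ∀ o i j → link o (i , j) (i , j) ≡ false
  lemma true  = from-yes (all? λ i → all? λ j → link true (i , j) (i , j) Bool.≟ false)
  lemma false = from-yes (all? λ i → all? λ j → link false (i , j) (i , j) Bool.≟ false)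

-- Vertices 0–11 form the gadget; classes 0, 1, 2, 3 start at 12, 27, 43, 60.
label : Fin 78 → Label
label = Vec.lookup (Vec.concat (Vec.tabulate λ i → Vec.tabulate {n = 3} λ j → i , punchIn i j)
  Vec.++ Vec.replicate 15 (# 0 , # 0)
  Vec.++ Vec.replicate 16 (# 1 , # 1)
  Vec.++ Vec.replicate 17 (# 2 , # 2)
  Vec.++ Vec.replicate 18 (# 3 , # 3))

Γ : Bool → Graph 78
Γ o = record
  { adj     = λ u v → link o (label u) (label v)
  ; adj-sym = λ u v → Bool.∨-comm (arc o (label u) (label v)) (arc o (label v) (label u))
  ; no-loop = λ v → link-irrefl o (label v)
  }

-- Class i ≢ 0 has parent (i , 0), which has parent (0 , i); any other gadget vertex
-- has its class as parent.  Vertex 0, with label (0 , 1), lies on a 2-cycle, so it is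
-- reached but not fixed.
parent : Fin 78 → Fin 78
parent u = Vec.lookup (Vec.lookup table (proj₁ (label u))) (proj₂ (label u))
  where
  open Vec using ([]; _∷_)
  table : Vec.Vec (Vec.Vec (Fin 78) 4) 4
  table = (# 0 ∷ # 12 ∷ # 12 ∷ # 12 ∷ [])
        ∷ (# 0 ∷ # 3  ∷ # 27 ∷ # 27 ∷ [])
        ∷ (# 1 ∷ # 43 ∷ # 6  ∷ # 43 ∷ [])
        ∷ (# 2 ∷ # 60 ∷ # 60 ∷ # 9  ∷ [])
        ∷ []

parent-adjacent : ∀ o u → Adjacent (Γ o) u (parent u)
parent-adjacent true  = from-yes (all? λ u → adj (Γ true) u (parent u) Bool.≟ true)
parent-adjacent false = from-yes (all? λ u → adj (Γ false) u (parent u) Bool.≟ true)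

-- The longest chains have five steps, for example from `(2 , 1)` through class 2, `(2 , 0)`,
-- `(0 , 2)` and class 0 to vertex 0.
ancestor-zero : ∀ u → ∃ λ (k : Fin 6) → iterate parent u (toℕ k) ≡ zero
ancestor-zero = from-yes (all? λ u → any? λ (k : Fin 6) → iterate parent u (toℕ k) Fin.≟ zero)

connected : ∀ o → Connected (Γ o)
connected o u v = to-zero u ◅◅ reverse (λ {x} {y} e → trans (adj-sym (Γ o) y x) e) (to-zero v)
  where
  to-zero : ∀ w → Star (Adjacent (Γ o)) w zero
  to-zero w = let k , eq = ancestor-zero w in
    subst (Star (Adjacent (Γ o)) w) eq (iterate-Star (parent-adjacent o) (toℕ k) w)

-- Neighbouring points suffice: class sizes are consecutive, so deleting a vertex of class `suc t`
-- makes it as large as class `inject₁ t`.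
swap : Fin 3 → Label → Label
swap t (i , j) = transpose (inject₁ t) (suc t) i , transpose (inject₁ t) (suc t) j

-- A transposition is odd, so it reverses each of the four 3-cycles.
link-swap : ∀ t x y → link true x y ≡ link false (swap t x) (swap t y)
link-swap t (i , j) (k , l) = lemma t i j k l
  where
  lemma : ∀ t i j k l → link true (i , j) (k , l) ≡ link false (swap t (i , j)) (swap t (k , l))
  lemma = from-yes (all? λ t → all? λ i → all? λ j → all? λ k → all? λ l →
    link true (i , j) (k , l) Bool.≟ link false (swap t (i , j)) (swap t (k , l)))

Swappable : Fin 78 → Fin 3 → Set
Swappable v t = ∀ i j →
  count _≟ₗ_ (swap t ∘ label ∘ punchIn v) (i , j) ≡ count _≟ₗ_ (label ∘ punchIn v) (i , j)

swappable? : ∀ v t → Dec (Swappable v t)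
swappable? v t = all? λ i → all? λ j → _ ℕ.≟ _

-- Adjacency depends on labels alone, so a permutation of the vertices that realises `swap t` on
-- labels is an isomorphism.
card-≅ : ∀ v t → Swappable v t → (Γ true -ᵛ v) ≅ (Γ false -ᵛ v)
card-≅ v t eq =
  let π , π-label = count-≡⇒permutation _≟ₗ_
        (swap t ∘ label ∘ punchIn v) (label ∘ punchIn v) (λ (i , j) → eq i j)
  in π , λ u w → trans (link-swap t (label (punchIn v u)) (label (punchIn v w)))
                       (cong₂ (link false) (π-label u) (π-label w))

-- The 27 vertices dropped are the 12 of the gadget and the 15 of class 0.
largerClasses : List (Fin 78)
largerClasses = drop 27 (allFin 78)

swappable : All (λ v → ∃ (Swappable v)) largerClasses
swappable = from-yes (All.all? (λ v → any? (swappable? v)) largerClasses)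

cards-≅ : All (λ v → (Γ true -ᵛ v) ≅ (Γ false -ᵛ v)) largerClasses
cards-≅ = All.map (λ {v} (t , eq) → card-≅ v t eq) swappable

-- Vertex 0 of Γ true has 15 neighbours of degree 3 and, in the gadget, neighbours of
-- degrees 19, 19, 20.  In Γ false no vertex of degree 18 attains the sum 103.
Γ-≇ : ¬ (Γ true ≅ Γ false)
Γ-≇ (π , π-adj) = unmatched (π ⟨$⟩ʳ zero)
  ( sym (degree-≅ (Γ true) (Γ false) π π-adj zero)
  , sym (neighbourSum-≅ (Γ true) (Γ false) π π-adj (degree (Γ true)) (degree (Γ false))
           (degree-≅ (Γ true) (Γ false) π π-adj) zero))
  where
  unmatched : ∀ v → ¬ (degree (Γ false) v ≡ 18 × neighbourSum (Γ false) (degree (Γ false)) v ≡ 103)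
  unmatched = from-yes (all? λ v → ¬?
    (degree (Γ false) v ℕ.≟ 18 ×-dec neighbourSum (Γ false) (degree (Γ false)) v ℕ.≟ 103))

-- In either orientation a gadget vertex has three gadget neighbours besides its class: its
-- reversal, its successor and its predecessor. Class vertices have degree 3.
degrees-Γ : degrees (Γ true) ≡ degrees (Γ false)
degrees-Γ = refl

theorem2p2 : ∃₂ λ (G H : Graph 78) →
    Connected G × Connected H × ¬ (G ≅ H) × degrees G ↭ degrees H ×
    b G H ≥ 51 × 51 > 50 × 50 ≡ Q 78
theorem2p2 = Γ true , Γ false , connected true , connected false , Γ-≇ ,
  ↭-reflexive degrees-Γ ,
  b-≥ (Γ true) (Γ false) {largerClasses} (drop-⊆ 27 (allFin 78)) cards-≅ ,
  ℕ.≤-refl , refl
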